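{- For any $w\in S_n$ and any climbing chain $C$ of $w$, $$\overline{\mathrm{raj}}(w)\le \#M(C).$$
   Context: Conventions. Permutations are in one-line notation; $t_{ij}$ is the transposition of $i,j$, and $wt_{ij}$ is $w$ with the values in positions $i$ and $j$ exchanged. $w_0\in S_n$ is the longest permutation, $w_0(k)=n+1-k$. The Bruhat order is the transitive closure of $w\le wt_{ij}$ for $i<j$ with $w(i)<w(j)$; $\lessdot$ denotes its cover relation. $[n]=\{1,\ldots,n\}$. Climbing chains. A climbing chain of $w\in S_n$ is a sequence $C=(C_1,\ldots,C_m)$ of pairs (links) $C_p=(i_p,j_p)$ with $i_p<j_p$, $i_1\le\cdots\le i_m$, $wt_{i_1j_1}\cdots t_{i_mj_m}=w_0$, and $wt_{i_1j_1}\cdots t_{i_{p-1}j_{p-1}}\lessdot wt_{i_1j_1}\cdots t_{i_pj_p}$ for each $p\in[m]$. (The only climbing chain of $w_0$ is empty.) The set of minimal markings is $M(C)=\{C_p\mid i_{p-1}<i_p,\text{ or } i_{p-1}=i_p\text{ and }j_{p-1}<j_p\}$ with $i_0=0$. Codes. $\overline{\mathrm{rajcode}}(w)_i$ is the maximal number $r$ of positions in a sequence $i=\alpha_1<\cdots<\alpha_r\le n$ with $w(\alpha_1)<\cdots<w(\alpha_r)$, minus one, and $\overline{\mathrm{raj}}(w)=\sum_{i=1}^n\overline{\mathrm{rajcode}}(w)_i$. -}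

module Defs where

open import Data.Nat.Base using (ℕ; _≤_; _∸_)
open import Data.Nat.Properties using (∸-monoˡ-≤; ≤-reflexive)
open import Data.Fin.Base as F using (Fin)
import Data.Fin.Properties as F
open import Data.Fin.Permutation using (Permutation′; _⟨$⟩ʳ_; _≈_; _∘ₚ_; transpose; reverse)
open import Data.List.Base using (List; []; _∷_; [_]; _++_; map; filter; length; foldl; allFin; deduplicate)
open import Data.List.Extrema.Nat using (max; argmax-sel; v≤max⁺)
open import Data.List.Membership.Propositional using (_∈_; lose)
open import Data.List.Membership.Propositional.Properties using (∈-allFin; ∈-map⁺; ∈-map⁻; ∈-++⁺ˡ; ∈-++⁺ʳ; ∈-filter⁺; ∈-filter⁻)
open import Data.List.Relation.Unary.All as All using (All; []; _∷_)
open import Data.List.Relation.Unary.AllPairs using (AllPairs; []; _∷_)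
import Data.List.Relation.Unary.AllPairs.Properties as AllPairs
open import Data.List.Relation.Unary.Any using (here; there)
open import Data.List.Relation.Unary.Linked as Linked using (Linked; []; [-]; _∷_)
open import Data.List.Relation.Unary.Linked.Properties using (Linked⇒AllPairs)
open import Data.Nat.ListAction using (sum)
open import Data.List.Scans.Base using (scanl)
open import Data.Product.Base using (_×_; _,_; proj₁; proj₂; ∃; ∃₂)
open import Data.Product.Properties using (≡-dec)
open import Data.Product.Relation.Binary.Lex.Strict using (×-Lex; ×-decidable)
open import Data.Sum.Base using (inj₁; inj₂)
open import Function.Base using (id; _on_)
open import Relation.Binary.Construct.Closure.Transitive using (TransClosure)
open import Relation.Binary.Definitions using (Decidable; DecidableEquality)
open import Relation.Binary.PropositionalEquality using (_≡_; refl; sym; cong)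
open import Relation.Nullary using (¬_; yes; no; contradiction)
open import Relation.Nullary.Decidable using (_×-dec_)
import Relation.Unary as U

private
  variable
    n : ℕ

-- Positions and values are elements of Fin n, i.e. 0, …, n-1 in place of
-- 1, …, n; only their order matters below.

------------------------------------------------------------------------
-- Bruhat order

Link : ℕ → Set
Link n = Fin n × Fin n

-- w · (i , j) is w t_{ij}: _∘ₚ_ applies its left argument first, so it is
-- the values of w in positions i and j that are exchanged.

infixl 7 _·_

_·_ : Permutation′ n → Link n → Permutation′ n
w · (i , j) = transpose i j ∘ₚ w

infix 4 _⊏_ _<ᴮ_ _⋖_

-- Permutations are compared by _≈_ (same one-line notation), because the
-- type also carries the inverse map and proofs.

_⊏_ : Permutation′ n → Permutation′ n → Set
w ⊏ u = ∃₂ λ i j → i F.< j × w ⟨$⟩ʳ i F.< w ⟨$⟩ʳ j × u ≈ w · (i , j)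

-- The strict Bruhat order; a chain of one or more steps is never closed
-- since every step increases the number of inversions.

_<ᴮ_ : Permutation′ n → Permutation′ n → Set
_<ᴮ_ = TransClosure _⊏_

_⋖_ : Permutation′ n → Permutation′ n → Set
w ⋖ u = w <ᴮ u × (∀ v → w <ᴮ v → ¬ v <ᴮ u)

------------------------------------------------------------------------
-- Climbing chains

-- scanl _·_ w C lists the partial products w, w t_{C₁}, w t_{C₁} t_{C₂}, …,
-- and foldl _·_ w C is the last of them.  `reverse` is w₀.

record IsClimbingChain (w : Permutation′ n) (C : List (Link n)) : Set where
  field
    links    : All (λ c → proj₁ c F.< proj₂ c) C
    climbing : Linked (F._≤_ on proj₁) C
    product  : foldl _·_ w C ≈ reverse
    covers   : Linked _⋖_ (scanl _·_ w C)

_<ₗ_ : Link n → Link n → Set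
_<ₗ_ = ×-Lex _≡_ F._<_ F._<_

_<ₗ?_ : Decidable (_<ₗ_ {n})
_<ₗ?_ = ×-decidable F._≟_ F._<?_ F._<?_

_≟ₗ_ : DecidableEquality (Link n)
_≟ₗ_ = ≡-dec F._≟_ F._≟_

markedAfter : Link n → List (Link n) → List (Link n)
markedAfter c []       = []
markedAfter c (d ∷ ds) with c <ₗ? d
... | yes _ = d ∷ markedAfter d ds
... | no  _ = markedAfter d ds

-- The first link is always marked: the convention i₀ = 0 puts i₀ below
-- every position.  M(C) is a set of links, hence the removal of duplicates.

minimalMarkings : List (Link n) → List (Link n)
minimalMarkings []       = []
minimalMarkings (c ∷ cs) = deduplicate _≟ₗ_ (c ∷ markedAfter c cs)

#M : List (Link n) → ℕ
#M C = length (minimalMarkings C)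

------------------------------------------------------------------------
-- Codes (overlined rajcode and raj in the literature)

-- A sequence of positions α₁ < ⋯ < αᵣ with w(α₁) < ⋯ < w(αᵣ).

Rising : Permutation′ n → List (Fin n) → Set
Rising w = Linked (λ a b → a F.< b × w ⟨$⟩ʳ a F.< w ⟨$⟩ʳ b)

rising? : (w : Permutation′ n) → U.Decidable (Rising w)
rising? w = Linked.linked? λ a b → (a F.<? b) ×-dec (w ⟨$⟩ʳ a F.<? w ⟨$⟩ʳ b)

sublists : {A : Set} → List A → List (List A)
sublists []       = [ [] ]
sublists (x ∷ xs) = sublists xs ++ map (x ∷_) (sublists xs)

risingFrom : Permutation′ n → Fin n → List (List (Fin n))
risingFrom {n} w i = filter (rising? w) (map (i ∷_) (sublists (allFin n)))

rajcode : Permutation′ n → Fin n → ℕ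
rajcode w i = max 0 (map length (risingFrom w i)) ∸ 1

raj : Permutation′ n → ℕ
raj {n} w = sum (map (rajcode w) (allFin n))

------------------------------------------------------------------------
-- risingFrom w i enumerates all rising sequences starting at i, so rajcode
-- is the maximal length, minus one, over all such sequences.

[]∈sublists : {A : Set} (xs : List A) → [] ∈ sublists xs
[]∈sublists []       = here refl
[]∈sublists (x ∷ xs) = ∈-++⁺ˡ ([]∈sublists xs)

private
  drop-head : ∀ {x : Fin n} {xs bs} → All (x F.<_) bs → All (_∈ x ∷ xs) bs → All (_∈ xs) bs
  drop-head []         []                  = []
  drop-head (x<b ∷ _)  (here refl ∷ _)     = contradiction x<b (F.<-irrefl refl)
  drop-head (_ ∷ x<bs) (there b∈xs ∷ bs∈)  = b∈xs ∷ drop-head x<bs bs∈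

  ∈-sublists : ∀ {xs bs : List (Fin n)} → AllPairs F._<_ xs → AllPairs F._<_ bs →
               All (_∈ xs) bs → bs ∈ sublists xs
  ∈-sublists {xs = xs} _ [] _ = []∈sublists xs
  ∈-sublists (x<xs ∷ xs↗) (b<bs ∷ bs↗) (here refl ∷ bs∈) =
    ∈-++⁺ʳ _ (∈-map⁺ _ (∈-sublists xs↗ bs↗ (drop-head b<bs bs∈)))
  ∈-sublists (x<xs ∷ xs↗) (b<bs ∷ bs↗) (there b∈xs ∷ bs∈) =
    ∈-++⁺ˡ (∈-sublists xs↗ (b<bs ∷ bs↗) (b∈xs ∷ drop-head (All.map (F.<-trans (All.lookup x<xs b∈xs)) b<bs) bs∈))

  allFin↗ : ∀ n → AllPairs F._<_ (allFin n)
  allFin↗ n = AllPairs.tabulate⁺-< id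

∈-risingFrom⁺ : ∀ {w : Permutation′ n} {i β} → Rising w (i ∷ β) → i ∷ β ∈ risingFrom w i
∈-risingFrom⁺ {n} {w} {i} {β} r with Linked⇒AllPairs F.<-trans (Linked.map proj₁ r)
... | _ ∷ β↗ = ∈-filter⁺ (rising? w) {xs = map (i ∷_) (sublists (allFin n))}
  (∈-map⁺ (i ∷_) (∈-sublists (allFin↗ n) β↗ (All.tabulate λ {x} _ → ∈-allFin x))) r

∈-risingFrom⁻ : ∀ {w : Permutation′ n} {i α} → α ∈ risingFrom w i →
                ∃ λ β → α ≡ i ∷ β × Rising w (i ∷ β)
∈-risingFrom⁻ {n} {w} {i} α∈ with ∈-filter⁻ (rising? w) {xs = map (i ∷_) (sublists (allFin n))} α∈
... | α∈′ , r with ∈-map⁻ (i ∷_) α∈′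
... | β , _ , refl = β , refl , r

rajcode-upper : ∀ {w : Permutation′ n} {i β} → Rising w (i ∷ β) → length β ≤ rajcode w i
rajcode-upper {w = w} {i} r = ∸-monoˡ-≤ 1
  (v≤max⁺ 0 (map length (risingFrom w i))
    (inj₂ (lose (∈-map⁺ length (∈-risingFrom⁺ {w = w} r)) (≤-reflexive refl))))

rajcode-attained : ∀ (w : Permutation′ n) i → ∃ λ β → Rising w (i ∷ β) × length β ≡ rajcode w i
rajcode-attained w i with argmax-sel id 0 (map length (risingFrom w i))
... | inj₁ max≡0 = [] , [-] , sym (cong (_∸ 1) max≡0)
... | inj₂ max∈ with ∈-map⁻ length max∈
... | α , α∈ , max≡ with ∈-risingFrom⁻ {w = w} α∈
... | β , refl , r = β , r , sym (cong (_∸ 1) max≡)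

{-# OPTIONS --safe #-}

-- Compare u with v = u t_{ij} for one link of the chain.  Rising sequences from
-- k ≠ i survive, so only rajcode at i can drop.  A longest sequence from i either
-- survives, or can be started at j instead (and then those from j can be started
-- at i, so raj does not drop), or loses its second element j.  Only in the last
-- case raj may drop, by one, and then some longest sequence of v from i continues
-- strictly to the right of j ("late").  Links (i , j′) with j′ ≤ j cause no drop
-- after this and preserve lateness, unless raj grows and makes up for the next
-- drop.  So raj drops by at most one from each marked link to the next.

module Submission where

open import Data.Fin.Base as F using (Fin; zero; suc; opposite)
import Data.Fin.Permutation.Components as PC
open import Data.Fin.Permutation using (Permutation′; _⟨$⟩ʳ_; _≈_; transpose; reverse)
import Data.Fin.Properties as F
open import Data.List.Base using (List; []; _∷_; length; deduplicate; foldl; tabulate)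
open import Data.List.Properties using (filter-all; map-tabulate)
open import Data.List.Relation.Unary.All as All using (All; []; _∷_)
open import Data.List.Relation.Unary.AllPairs using (AllPairs; []; _∷_)
open import Data.List.Relation.Unary.Linked as Linked using (Linked; [-]; _∷_)
open import Data.List.Relation.Unary.Linked.Properties using (Linked⇒AllPairs)
open import Data.List.Scans.Base using (scanl)
open import Data.Nat.Base using (ℕ; zero; suc; _+_; _≤_; _<_; z≤n; s≤s)
import Data.Nat.ListAction as List
open import Data.Nat.Properties
open import Data.Product.Base using (_×_; _,_; proj₁; proj₂; ∃)
open import Data.Sum.Base using (_⊎_; inj₁; inj₂)
open import Function.Base using (_∘_; _on_)
open import Function.Bundles using (Injection)
open import Function.Properties.Inverse using (↔⇒↣)
open import Relation.Binary.Construct.Closure.Transitive using ([_]; _∷_)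
open import Relation.Binary.Definitions using (DecidableEquality; tri<; tri≈; tri>)
open import Relation.Binary.PropositionalEquality
open import Relation.Nullary using (¬_; yes; no; contradiction)
open import Relation.Nullary.Decidable using (dec-true; dec-false; toSum; ¬?)
open import Defs

open import Algebra.Properties.CommutativeMonoid.Sum +-0-commutativeMonoid using (sum; sum-permute)

private
  variable
    n : ℕ
    w x y : Permutation′ n
    i j k : Fin n
    C : List (Link n)

-- Sums

sum-tabulate : (f : Fin n → ℕ) → List.sum (tabulate f) ≡ sum f
sum-tabulate {zero}  f = refl
sum-tabulate {suc n} f = cong (f zero +_) (sum-tabulate (f ∘ suc))

raj≡sum : (w : Permutation′ n) → raj w ≡ sum (rajcode w)
raj≡sum {n} w = trans (cong List.sum (map-tabulate {n = n} (λ k → k) (rajcode w))) (sum-tabulate (rajcode w))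

sum-mono : {f g : Fin n → ℕ} → (∀ k → f k ≤ g k) → sum f ≤ sum g
sum-mono {zero}  f≤g = z≤n
sum-mono {suc n} f≤g = +-mono-≤ (f≤g zero) (sum-mono (f≤g ∘ suc))

+-left-comm : ∀ a b c → a + (b + c) ≡ b + (a + c)
+-left-comm a b c = trans (sym (+-assoc a b c)) (trans (cong (_+ c) (+-comm a b)) (+-assoc b a c))

-- The numbers `a` and `b` record what happens at the exceptional index without subtraction: `a = 1`
-- expresses a strict gain, `b = 1` a loss of at most one.
sum-mono-at : {f g : Fin n → ℕ} (i : Fin n) (a b : ℕ) →
              (∀ k → k ≢ i → f k ≤ g k) → a + f i ≤ b + g i → a + sum f ≤ b + sum g
sum-mono-at {suc n} {f} {g} zero a b f≤g fi≤gi =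
  subst₂ _≤_ (+-assoc a (f zero) _) (+-assoc b (g zero) _)
    (+-mono-≤ fi≤gi (sum-mono λ k → f≤g (suc k) λ ()))
sum-mono-at {suc n} {f} {g} (suc i) a b f≤g fi≤gi =
  subst₂ _≤_ (+-left-comm (f zero) a _) (+-left-comm (g zero) b _)
    (+-mono-≤ (f≤g zero λ ())
      (sum-mono-at i a b (λ k k≢i → f≤g (suc k) (k≢i ∘ F.suc-injective)) fi≤gi))

-- Exchanging two values

⟨$⟩ʳ-injective : (w : Permutation′ n) → w ⟨$⟩ʳ i ≡ w ⟨$⟩ʳ j → i ≡ j
⟨$⟩ʳ-injective w = Injection.injective (↔⇒↣ w)

transpose-left : (i j : Fin n) → PC.transpose i j i ≡ j
transpose-left i j rewrite dec-true (i F.≟ i) refl = refl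

transpose-right : (i j : Fin n) → j ≢ i → PC.transpose i j j ≡ i
transpose-right i j j≢i rewrite dec-false (j F.≟ i) j≢i | dec-true (j F.≟ j) refl = refl

transpose-other : (i j : Fin n) → k ≢ i → k ≢ j → PC.transpose i j k ≡ k
transpose-other {k = k} i j k≢i k≢j
  rewrite dec-false (k F.≟ i) k≢i | dec-false (k F.≟ j) k≢j = refl

module _ (w : Permutation′ n) (i j : Fin n) where

  ·-left : (w · (i , j)) ⟨$⟩ʳ i ≡ w ⟨$⟩ʳ j
  ·-left = cong (w ⟨$⟩ʳ_) (transpose-left i j)

  ·-right : i F.< j → (w · (i , j)) ⟨$⟩ʳ j ≡ w ⟨$⟩ʳ i
  ·-right i<j = cong (w ⟨$⟩ʳ_) (transpose-right i j (≢-sym (F.<⇒≢ i<j)))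

  ·-other : k ≢ i → k ≢ j → (w · (i , j)) ⟨$⟩ʳ k ≡ w ⟨$⟩ʳ k
  ·-other k≢i k≢j = cong (w ⟨$⟩ʳ_) (transpose-other i j k≢i k≢j)

-- Bruhat covers

-- Bruhat steps increase one-line notation lexicographically; this recovers
-- w(i) < w(j) from the bare fact that w t_{ij} lies above w.

_<ˡᵉˣ_ : Permutation′ n → Permutation′ n → Set
w <ˡᵉˣ x = ∃ λ k → (∀ p → p F.< k → w ⟨$⟩ʳ p ≡ x ⟨$⟩ʳ p) × w ⟨$⟩ʳ k F.< x ⟨$⟩ʳ k

<ˡᵉˣ-trans : w <ˡᵉˣ x → x <ˡᵉˣ y → w <ˡᵉˣ y
<ˡᵉˣ-trans {w = w} {y = y} (k , eq , lt) (l , eq′ , lt′) with F.<-cmp k l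
... | tri< k<l _ _ = k , (λ p p<k → trans (eq p p<k) (eq′ p (F.<-trans p<k k<l))) , subst (w ⟨$⟩ʳ k F.<_) (eq′ k k<l) lt
... | tri≈ _ refl _ = k , (λ p p<k → trans (eq p p<k) (eq′ p p<k)) , F.<-trans lt lt′
... | tri> _ _ l<k = l , (λ p p<l → trans (eq p (F.<-trans p<l l<k)) (eq′ p p<l)) , subst (F._< y ⟨$⟩ʳ l) (sym (eq l l<k)) lt′

⊏⇒<ˡᵉˣ : w ⊏ x → w <ˡᵉˣ x
⊏⇒<ˡᵉˣ {w = w} {x = x} (i , j , i<j , wi<wj , x≈) = i
  , (λ p p<i → sym (trans (x≈ p) (·-other w i j (F.<⇒≢ p<i) (F.<⇒≢ (F.<-trans p<i i<j)))))
  , subst (w ⟨$⟩ʳ i F.<_) (sym (trans (x≈ i) (·-left w i j))) wi<wj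

<ᴮ⇒<ˡᵉˣ : w <ᴮ x → w <ˡᵉˣ x
<ᴮ⇒<ˡᵉˣ {w = w} {x = x} [ w⊏x ] = ⊏⇒<ˡᵉˣ {w = w} {x = x} w⊏x
<ᴮ⇒<ˡᵉˣ {w = w} {x = x} (_∷_ {y = y} w⊏y y<x) =
  <ˡᵉˣ-trans {w = w} {x = y} {y = x} (⊏⇒<ˡᵉˣ {w = w} {x = y} w⊏y) (<ᴮ⇒<ˡᵉˣ y<x)

-- The classical local description of a Bruhat cover, in which the order itself no longer appears.
record Saturated (w : Permutation′ n) (i j : Fin n) : Set where
  field
    pos : i F.< j
    val : w ⟨$⟩ʳ i F.< w ⟨$⟩ʳ j
    gap : ∀ q → i F.< q → q F.< j → w ⟨$⟩ʳ i F.< w ⟨$⟩ʳ q → ¬ w ⟨$⟩ʳ q F.< w ⟨$⟩ʳ j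

<ᴮ-swap⇒val : (w : Permutation′ n) → i F.< j → w <ᴮ (w · (i , j)) → w ⟨$⟩ʳ i F.< w ⟨$⟩ʳ j
<ᴮ-swap⇒val {i = i} {j} w i<j w<wij with <ᴮ⇒<ˡᵉˣ w<wij
... | k , eq , lt with toSum (k F.≟ i) | toSum (k F.≟ j)
... | inj₁ refl | _         = subst (w ⟨$⟩ʳ i F.<_) (·-left w i j) lt
-- A first difference at `j` would mean agreement at the earlier position `i`, hence w(i) = w(j).
... | inj₂ _    | inj₁ refl = contradiction (⟨$⟩ʳ-injective w (trans (eq i i<j) (·-left w i j))) (F.<⇒≢ i<j)
... | inj₂ k≢i  | inj₂ k≢j  = contradiction (sym (·-other w i j k≢i k≢j)) (F.<⇒≢ lt)

-- (a,c,b) ⊏ (c,a,b) ⊏ (b,a,c) ⊏ (b,c,a) in positions i < q < j.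
<ᴮ-between : (w : Permutation′ n) {i q j : Fin n} → i F.< q → q F.< j →
             w ⟨$⟩ʳ i F.< w ⟨$⟩ʳ q → w ⟨$⟩ʳ q F.< w ⟨$⟩ʳ j →
             (w · (i , q)) <ᴮ (w · (i , j))
<ᴮ-between {n} w {i} {q} {j} i<q q<j wi<wq wq<wj =
  _∷_ {y = w₂} (i , j , i<j , subst₂ F._<_ (sym w₁i) (sym w₁j) wq<wj , λ _ → refl)
    [ q , j , q<j , subst₂ F._<_ (sym w₂q) (sym w₂j) wi<wq , last ]
  where
  i<j = F.<-trans i<q q<j
  w₁ = w · (i , q)
  w₂ = w₁ · (i , j)
  w₁i : w₁ ⟨$⟩ʳ i ≡ w ⟨$⟩ʳ q
  w₁i = ·-left w i q
  w₁q : w₁ ⟨$⟩ʳ q ≡ w ⟨$⟩ʳ i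
  w₁q = ·-right w i q i<q
  w₁j : w₁ ⟨$⟩ʳ j ≡ w ⟨$⟩ʳ j
  w₁j = ·-other w i q (≢-sym (F.<⇒≢ i<j)) (≢-sym (F.<⇒≢ q<j))
  w₂i : w₂ ⟨$⟩ʳ i ≡ w ⟨$⟩ʳ j
  w₂i = trans (·-left w₁ i j) w₁j
  w₂q : w₂ ⟨$⟩ʳ q ≡ w ⟨$⟩ʳ i
  w₂q = trans (·-other w₁ i j (≢-sym (F.<⇒≢ i<q)) (F.<⇒≢ q<j)) w₁q
  w₂j : w₂ ⟨$⟩ʳ j ≡ w ⟨$⟩ʳ q
  w₂j = trans (·-right w₁ i j i<j) w₁i
  last : (w · (i , j)) ≈ (w₂ · (q , j))
  last k with toSum (k F.≟ i) | toSum (k F.≟ q) | toSum (k F.≟ j)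
  ... | inj₁ refl | _ | _ = trans (·-left w i j) (sym (trans (·-other w₂ q j (F.<⇒≢ i<q) (F.<⇒≢ i<j)) w₂i))
  ... | inj₂ k≢i | inj₁ refl | _ = trans (·-other w i j k≢i (F.<⇒≢ q<j)) (sym (trans (·-left w₂ q j) w₂j))
  ... | inj₂ k≢i | inj₂ k≢q | inj₁ refl = trans (·-right w i j i<j) (sym (trans (·-right w₂ q j q<j) w₂q))
  ... | inj₂ k≢i | inj₂ k≢q | inj₂ k≢j = trans (·-other w i j k≢i k≢j) (sym (trans (·-other w₂ q j k≢q k≢j)
      (trans (·-other w₁ i j k≢i k≢j) (·-other w i q k≢i k≢q))))

-- A position `q` violating `gap` would put `w · (i , q)` strictly between the two ends of the
-- cover.
⋖⇒Saturated : i F.< j → w ⋖ (w · (i , j)) → Saturated w i j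
⋖⇒Saturated {i = i} {j} {w = w} i<j (w<wij , minimal) = record
  { pos = i<j
  ; val = <ᴮ-swap⇒val w i<j w<wij
  ; gap = λ q i<q q<j wi<wq wq<wj →
      minimal (w · (i , q)) [ i , q , i<q , wi<wq , (λ _ → refl) ] (<ᴮ-between w i<q q<j wi<wq wq<wj)
  }

data Climbs {n : ℕ} : Permutation′ n → List (Link n) → Set where
  []  : w ≈ reverse → Climbs w []
  _∷_ : Saturated w i j → Climbs (w · (i , j)) C → Climbs w ((i , j) ∷ C)

climbs : (w : Permutation′ n) (C : List (Link n)) → All (λ c → proj₁ c F.< proj₂ c) C →
         foldl _·_ w C ≈ reverse → Linked _⋖_ (scanl _·_ w C) → Climbs w C
climbs w []            _            w≈w₀ _         = [] w≈w₀
climbs w ((i , j) ∷ C) (i<j ∷ i<js) w≈w₀ (w⋖ ∷ ⋖s) =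
  ⋖⇒Saturated i<j w⋖ ∷ climbs (w · (i , j)) C i<js w≈w₀ ⋖s

-- Positions that have reached their final value

Dominant : Permutation′ n → Fin n → Set
Dominant w i = ∀ {p q} → p F.< i → p F.< q → w ⟨$⟩ʳ q F.< w ⟨$⟩ʳ p

opposite-anti : {p q : Fin n} → p F.< q → opposite q F.< opposite p
opposite-anti {n} {p} {q} p<q = subst₂ _<_ (sym (F.opposite-prop q)) (sym (F.opposite-prop p))
  (∸-monoʳ-< (s≤s p<q) (F.toℕ<n q))

≈reverse-anti : w ≈ reverse → {p q : Fin n} → p F.< q → w ⟨$⟩ʳ q F.< w ⟨$⟩ʳ p
≈reverse-anti w≈w₀ {p} {q} p<q = subst₂ F._<_ (sym (w≈w₀ q)) (sym (w≈w₀ p)) (opposite-anti p<q)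

-- Induction from the end of the chain, where w₀ is decreasing. A link at `a ≥ i` fixes every
-- `p < i` and moves the other values only among positions to the right of `p`.
dominant : (w : Permutation′ n) → All (λ c → i F.≤ proj₁ c) C → Climbs w C → Dominant w i
dominant w _ ([] w≈w₀) _ p<q = ≈reverse-anti {w = w} w≈w₀ p<q
dominant {i = i} w (i≤a ∷ i≤as) (_∷_ {i = a} {j = b} s cl) {p} {q} p<i p<q =
  subst (w ⟨$⟩ʳ q F.<_) (·-other w a b (F.<⇒≢ p<a) (F.<⇒≢ p<b)) uq<
  where
  open Saturated s
  u = w · (a , b)
  p<a : p F.< a
  p<a = <-≤-trans p<i i≤a
  p<b = F.<-trans p<a pos
  dom : ∀ {k} → p F.< k → u ⟨$⟩ʳ k F.< u ⟨$⟩ʳ p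
  dom = dominant u i≤as cl p<i
  uq< : w ⟨$⟩ʳ q F.< u ⟨$⟩ʳ p
  uq< with toSum (q F.≟ a) | toSum (q F.≟ b)
  ... | inj₁ refl | _         = subst (F._< u ⟨$⟩ʳ p) (·-right w a b pos) (dom p<b)
  ... | inj₂ _    | inj₁ refl = subst (F._< u ⟨$⟩ʳ p) (·-left w a b) (dom p<a)
  ... | inj₂ q≢a  | inj₂ q≢b  = subst (F._< u ⟨$⟩ʳ p) (·-other w a b q≢a q≢b) (dom p<q)

anti⇒rajcode≡0 : (w : Permutation′ n) {p : Fin n} →
                 (∀ {q} → p F.< q → w ⟨$⟩ʳ q F.< w ⟨$⟩ʳ p) → rajcode w p ≡ 0
anti⇒rajcode≡0 w {p} anti with rajcode-attained w p
... | []    , _                     , eq = sym eq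
... | _ ∷ _ , (p<q , wp<wq) ∷ _ , _ = contradiction wp<wq (F.<-asym (anti p<q))

raj-reverse : (w : Permutation′ n) → w ≈ reverse → raj w ≤ 0
raj-reverse {n} w w≈w₀ = subst (_≤ 0) (sym (raj≡sum w)) (sum≤0 λ k → ≤-reflexive (anti⇒rajcode≡0 w {k} (≈reverse-anti {w = w} w≈w₀ {k})))
  where
  sum≤0 : ∀ {m} {f : Fin m → ℕ} → (∀ k → f k ≤ 0) → sum f ≤ 0
  sum≤0 {zero}  _   = z≤n
  sum≤0 {suc m} f≤0 = +-mono-≤ (f≤0 zero) (sum≤0 (f≤0 ∘ suc))

-- Effect of a link on the code

rajcode-mono : (u v : Permutation′ n) {a b : Fin n} →
               (∀ {β} → Rising u (a ∷ β) → Rising v (b ∷ β)) → rajcode u a ≤ rajcode v b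
rajcode-mono u v {a} f with rajcode-attained u a
... | β , r , eq = subst (_≤ _) eq (rajcode-upper {w = v} (f r))

-- By `rajcode-upper` the last inequality says that `i ∷ β` is longest. `β` may be empty, so code
-- zero at `i` counts as late.
Late : Permutation′ n → Link n → Set
Late w (i , j) = ∃ λ β → Rising w (i ∷ β) × All (j F.<_) β × rajcode w i ≤ length β

late-or-longer : (w : Permutation′ n) {β : List (Fin n)} → Rising w (i ∷ β) → All (j F.<_) β →
                 length β < rajcode w i ⊎ Late w (i , j)
late-or-longer {i = i} w {β} r after with rajcode w i ≤? length β
... | yes opt = inj₂ (β , r , after , opt)
... | no ¬opt = inj₁ (≰⇒> ¬opt)

rising⇒after : (w : Permutation′ n) {β : List (Fin n)} → Rising w (i ∷ β) → All (i F.<_) β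
rising⇒after w r with Linked⇒AllPairs F.<-trans (Linked.map proj₁ r)
... | i<β ∷ _ = i<β

module Step (u : Permutation′ n) {i j : Fin n} (s : Saturated u i j) (dom : Dominant u i) where
  open Saturated s

  v = u · (i , j)

  vi≡uj : v ⟨$⟩ʳ i ≡ u ⟨$⟩ʳ j
  vi≡uj = ·-left u i j

  vj≡ui : v ⟨$⟩ʳ j ≡ u ⟨$⟩ʳ i
  vj≡ui = ·-right u i j pos

  v≡u : k ≢ i → k ≢ j → v ⟨$⟩ʳ k ≡ u ⟨$⟩ʳ k
  v≡u = ·-other u i j

  -- To the right of `i` only the value at `j` changes, and it drops to u(i). So only an ascent
  -- ending at `j` is in danger, and there `gap` forces u(a) < u(i).
  ascent : ∀ {a b} → i F.< a → a F.< b → u ⟨$⟩ʳ a F.< u ⟨$⟩ʳ b → v ⟨$⟩ʳ a F.< v ⟨$⟩ʳ b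
  ascent {a} {b} i<a a<b ua<ub with toSum (a F.≟ j) | toSum (b F.≟ j)
  ... | inj₁ refl | _ =
    subst₂ F._<_ (sym vj≡ui) (sym (v≡u (≢-sym (F.<⇒≢ (F.<-trans i<a a<b))) (≢-sym (F.<⇒≢ a<b))))
      (F.<-trans val ua<ub)
  ... | inj₂ a≢j | inj₂ b≢j =
    subst₂ F._<_ (sym (v≡u (≢-sym (F.<⇒≢ i<a)) a≢j)) (sym (v≡u (≢-sym (F.<⇒≢ (F.<-trans i<a a<b))) b≢j)) ua<ub
  ... | inj₂ a≢j | inj₁ refl with F.<-cmp (u ⟨$⟩ʳ a) (u ⟨$⟩ʳ i)
  ...   | tri< ua<ui _ _ = subst₂ F._<_ (sym (v≡u (≢-sym (F.<⇒≢ i<a)) a≢j)) (sym vj≡ui) ua<ui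
  ...   | tri≈ _ ua≡ui _ = contradiction (sym (⟨$⟩ʳ-injective u ua≡ui)) (F.<⇒≢ i<a)
  ...   | tri> _ _ ui<ua = contradiction ua<ub (gap a i<a a<b ui<ua)

  rising : ∀ {a β} → i F.< a → Rising u (a ∷ β) → Rising v (a ∷ β)
  rising i<a [-]                   = [-]
  rising i<a ((a<b , ua<ub) ∷ r) = (a<b , ascent i<a a<b ua<ub) ∷ rising (F.<-trans i<a a<b) r

  rising-i : ∀ {b β} → i F.< b → u ⟨$⟩ʳ j F.< u ⟨$⟩ʳ b → Rising u (b ∷ β) → Rising v (i ∷ b ∷ β)
  rising-i i<b uj<ub r =
    (i<b , subst₂ F._<_ (sym vi≡uj) (sym (v≡u (≢-sym (F.<⇒≢ i<b)) λ { refl → F.<-irrefl refl uj<ub })) uj<ub)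
    ∷ rising i<b r

  rising-j⇒i : ∀ {β} → Rising u (j ∷ β) → Rising v (i ∷ β)
  rising-j⇒i [-]                   = [-]
  rising-j⇒i ((j<b , uj<ub) ∷ r) = rising-i (F.<-trans pos j<b) uj<ub r

  code-i : rajcode u j ≤ rajcode v i
  code-i = rajcode-mono u v rising-j⇒i

  -- Sequences from the left of `i` might pass through `i` and break, but `dom` gives those
  -- positions code zero.
  code-other : ∀ k → k ≢ i → rajcode u k ≤ rajcode v k
  code-other k k≢i with F.<-cmp k i
  ... | tri< k<i _ _ = subst (_≤ rajcode v k) (sym (anti⇒rajcode≡0 u (dom k<i))) z≤n
  ... | tri≈ _ k≡i _ = contradiction k≡i k≢i
  ... | tri> _ _ i<k = rajcode-mono u v (rising i<k)

  raj-mono : (a b : ℕ) → a + rajcode u i ≤ b + rajcode v i → a + raj u ≤ b + raj v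
  raj-mono a b le rewrite raj≡sum u | raj≡sum v = sum-mono-at i a b code-other le

  exchanged : Fin n → ℕ
  exchanged = rajcode u ∘ PC.transpose i j

  exchanged-i : exchanged i ≡ rajcode u j
  exchanged-i = cong (rajcode u) (transpose-left i j)

  -- The codes of `u` at `i` and `j` are swapped before the termwise comparison, which leaves their
  -- sum unchanged. Thus a drop at `i` is harmless if the two codes merely trade places.
  raj-mono-exchanged : (b : ℕ) → rajcode u i ≤ rajcode v j → b + rajcode u j ≤ rajcode v i → b + raj u ≤ raj v
  raj-mono-exchanged b i≤j j≤i rewrite raj≡sum u | raj≡sum v =
    subst (λ m → b + m ≤ sum (rajcode v)) (sym (sum-permute (rajcode u) (transpose i j)))
      (sum-mono-at i b 0 others (subst (λ m → b + m ≤ rajcode v i) (sym exchanged-i) j≤i))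
    where
    others : ∀ k → k ≢ i → exchanged k ≤ rajcode v k
    others k k≢i with toSum (k F.≟ j)
    ... | inj₁ refl = subst (_≤ rajcode v j) (sym (cong (rajcode u) (transpose-right i j k≢i))) i≤j
    ... | inj₂ k≢j   = subst (_≤ rajcode v k) (sym (cong (rajcode u) (transpose-other i j k≢i k≢j))) (code-other k k≢i)

  -- No drop, together with a resource for the next link: a surplus of one to pay for a drop, or
  -- lateness to prevent it.
  Outcome : ℕ → Set
  Outcome m = m < raj v ⊎ (m ≤ raj v × Late v (i , j))

  kept : ∀ {β} → Rising v (i ∷ β) → rajcode u i ≤ length β → All (j F.<_) β → Outcome (raj u)
  kept r opt after with late-or-longer v r after
  ... | inj₁ longer = inj₁ (raj-mono 1 0 (≤-<-trans opt longer))
  ... | inj₂ late   = inj₂ (raj-mono 0 0 (≤-trans opt (rajcode-upper {w = v} r)) , late)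

  moved : rajcode u i ≤ rajcode v j → Outcome (raj u)
  moved i≤j with rajcode-attained u j
  -- A longest tail from `j` also follows `i` in `v`, and it lies beyond `j` automatically. Either
  -- it is longest there too, giving lateness, or the code at `i` beats it, giving a surplus.
  ... | β , r , eq with late-or-longer v (rising-j⇒i r) (rising⇒after u r)
  ...   | inj₁ longer = inj₁ (raj-mono-exchanged 1 i≤j (subst (_< rajcode v i) eq longer))
  ...   | inj₂ late   = inj₂ (raj-mono-exchanged 0 i≤j code-i , late)

  step-late : ∀ {j₀} → j F.≤ j₀ → Late u (i , j₀) → Outcome (raj u)
  step-late j≤j₀ ([] , r , _ , opt) = kept [-] opt []
  step-late j≤j₀ (q ∷ β , (i<q , ui<uq) ∷ r , j₀<q ∷ j₀<β , opt) with F.<-cmp (u ⟨$⟩ʳ j) (u ⟨$⟩ʳ q)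
  ... | tri< uj<uq _ _ = kept (rising-i i<q uj<uq r) opt (≤-<-trans j≤j₀ j₀<q ∷ All.map (≤-<-trans j≤j₀) j₀<β)
  ... | tri≈ _ uj≡uq _ = contradiction (⟨$⟩ʳ-injective u uj≡uq) (F.<⇒≢ (≤-<-trans j≤j₀ j₀<q))
  -- The value at `i` has risen above u(q), but `j` now carries u(i) and lies before `q`, so the
  -- sequence can start at `j`.
  ... | tri> _ _ uq<uj = moved (≤-trans opt (rajcode-upper {w = v}
      ((≤-<-trans j≤j₀ j₀<q , subst₂ F._<_ (sym vj≡ui) (sym (v≡u (≢-sym (F.<⇒≢ i<q)) λ { refl → F.<-irrefl refl uq<uj })) ui<uq)
       ∷ rising i<q r)))

  weaken : Outcome (raj u) → raj u ≤ raj v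
  weaken (inj₁ lt)       = <⇒≤ lt
  weaken (inj₂ (le , _)) = le

  step : raj u ≤ raj v ⊎ (raj u ≤ suc (raj v) × Late v (i , j))
  step with rajcode-attained u i
  ... | [] , _ , eq = inj₁ (raj-mono 0 0 (subst (_≤ rajcode v i) eq z≤n))
  ... | q ∷ β , (i<q , ui<uq) ∷ r , eq with F.<-cmp q j
  -- The sequence already makes `u` late for `(i , j)`.
  ...   | tri> _ _ j<q = inj₁ (weaken (step-late ≤-refl
            (q ∷ β , (i<q , ui<uq) ∷ r , j<q ∷ All.map (F.<-trans j<q) (rising⇒after u r) , ≤-reflexive (sym eq))))
  -- Here `gap` puts u(q) above u(j), so the sequence survives the larger value at `i`.
  ...   | tri< q<j _ _ = inj₁ (raj-mono 0 0 (subst (_≤ rajcode v i) eq (rajcode-upper {w = v} (rising-i i<q uj<uq r))))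
    where
    uj<uq : u ⟨$⟩ʳ j F.< u ⟨$⟩ʳ q
    uj<uq with F.<-cmp (u ⟨$⟩ʳ j) (u ⟨$⟩ʳ q)
    ... | tri< lt _ _ = lt
    ... | tri≈ _ e _  = contradiction (sym (⟨$⟩ʳ-injective u e)) (F.<⇒≢ q<j)
    ... | tri> _ _ gt = contradiction gt (gap q i<q q<j ui<uq)
  -- Deleting `j` leaves a sequence one shorter. Either a longer one exists in `v` and makes up for
  -- the loss, or the shortened one is longest and lies beyond `j`.
  ...   | tri≈ _ refl _ with late-or-longer v (rising-j⇒i r) (rising⇒after u r)
  ...     | inj₁ longer = inj₁ (raj-mono 0 0 (subst (_≤ rajcode v i) eq longer))
  ...     | inj₂ late   = inj₂ (raj-mono 0 1 (subst (_≤ suc (rajcode v i)) eq (s≤s (rajcode-upper {w = v} (rising-j⇒i r)))) , late)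

-- Counting markings

Climbing : List (Link n) → Set
Climbing = Linked (F._≤_ on proj₁)

climbing⇒AllPairs : Climbing C → AllPairs (F._≤_ on proj₁) C
climbing⇒AllPairs = Linked⇒AllPairs ≤-trans

climbing⇒dominant : (w : Permutation′ n) {c : Link n} → Climbing (c ∷ C) → Climbs w (c ∷ C) → Dominant w (proj₁ c)
climbing⇒dominant w lk cl with climbing⇒AllPairs lk
... | i≤ ∷ _ = dominant w (≤-refl ∷ i≤) cl

≮ₗ⇒ : (c d : Link n) → proj₁ c F.≤ proj₁ d → ¬ (c <ₗ d) → proj₁ c ≡ proj₁ d × proj₂ d F.≤ proj₂ c
≮ₗ⇒ c d c≤d c≮d with F.<-cmp (proj₁ c) (proj₁ d)
... | tri< lt _ _ = contradiction (inj₁ lt) c≮d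
... | tri≈ _ eq _ = eq , ≮⇒≥ (λ lt → c≮d (inj₂ (eq , lt)))
... | tri> _ _ gt = contradiction c≤d (<⇒≱ gt)

mutual

  raj≤1+marked : (w : Permutation′ n) (c : Link n) (C : List (Link n)) →
                 Climbing (c ∷ C) → Climbs w (c ∷ C) → raj w ≤ suc (length (markedAfter c C))
  raj≤1+marked w c C lk cl@(s ∷ cl′) with Step.step w s (climbing⇒dominant w lk cl) | raj≤marked (w · c) c C lk cl′
  ... | inj₁ le          | bound , _     = ≤-trans le bound
  ... | inj₂ (le , late) | _     , late⇒ = ≤-trans le (s≤s (late⇒ late))

  -- Here `c` has just been applied. The extra one leaves room for a drop before the next mark; when
  -- `w` is late, that room is given back.
  raj≤marked : (w : Permutation′ n) (c : Link n) (C : List (Link n)) → Climbing (c ∷ C) → Climbs w C →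
               raj w ≤ suc (length (markedAfter c C)) × (Late w c → raj w ≤ length (markedAfter c C))
  raj≤marked w c [] _ ([] w≈w₀) = m≤n⇒m≤1+n (raj-reverse w w≈w₀) , λ _ → raj-reverse w w≈w₀
  raj≤marked w c (d ∷ C) (c≤d ∷ lk) cl@(s ∷ cl′) with c <ₗ? d
  -- The mark on `d` adds one to the count, which is exactly the allowance in the bound starting
  -- from `d`.
  ... | yes _   = m≤n⇒m≤1+n (raj≤1+marked w d C lk cl) , λ _ → raj≤1+marked w d C lk cl
  ... | no c≮d with ≮ₗ⇒ c d c≤d c≮d
  ...   | refl , d≤c = raj≤1+marked w d C lk cl , late⇒
    where
    late⇒ : Late w c → raj w ≤ length (markedAfter d C)
    late⇒ late with Step.step-late w s (climbing⇒dominant w lk cl) d≤c late | raj≤marked (w · d) d C lk cl′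
    -- The surplus cancels the allowance of one in the general bound.
    ... | inj₁ lt           | bound , _   = ≤-pred (≤-trans lt bound)
    ... | inj₂ (le , late′) | _     , ih = ≤-trans le (ih late′)

-- Links do not repeat

-- Using `(i , j)` again would require w(i) < w(j). Other links at `i` only raise the value at `i`
-- and fix `j`; once the chain moves past `i`, it never returns.
link-fresh : (w : Permutation′ n) → w ⟨$⟩ʳ j F.< w ⟨$⟩ʳ i → All (λ c → i F.≤ proj₁ c) C →
             Climbing C → Climbs w C → All ((i , j) ≢_) C
link-fresh w _ _ _ ([] _) = []
link-fresh {j = j} {i = i} w wj<wi (i≤a ∷ i≤as) lk (_∷_ {i = a} {j = b} s cl) = new ∷ rest
  where
  open Saturated s
  new : (i , j) ≢ (a , b)
  new refl = F.<-asym wj<wi val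
  rest : All ((i , j) ≢_) _
  rest with toSum (i F.≟ a) | climbing⇒AllPairs lk
  ... | inj₂ i≢a  | a≤ ∷ _ = All.map (λ { a≤i refl → i≢a (F.≤-antisym i≤a a≤i) }) a≤
  ... | inj₁ refl | _      = link-fresh (w · (a , b))
    (subst₂ F._<_ (sym (·-other w a b (λ { refl → F.<-irrefl refl wj<wi }) (λ { refl → new refl })))
      (sym (·-left w a b)) (F.<-trans wj<wi val))
    i≤as (Linked.tail lk) cl

-- This makes `deduplicate` act as the identity in `minimalMarkings`, so that marked links can be
-- counted along the chain.
links-distinct : (w : Permutation′ n) → Climbing C → Climbs w C → AllPairs _≢_ C
links-distinct w _ ([] _) = []
links-distinct w lk (_∷_ {i = a} {j = b} s cl) with climbing⇒AllPairs lk
... | a≤ ∷ _ = link-fresh (w · (a , b)) (subst₂ F._<_ (sym (·-right w a b pos)) (sym (·-left w a b)) val) a≤ (Linked.tail lk) cl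
             ∷ links-distinct (w · (a , b)) (Linked.tail lk) cl
  where open Saturated s

markedAfter-All : {P : Link n → Set} (c : Link n) → All P C → All P (markedAfter c C)
markedAfter-All c [] = []
markedAfter-All c (_∷_ {x = d} pd pC) with c <ₗ? d
... | yes _ = pd ∷ markedAfter-All d pC
... | no  _ = markedAfter-All d pC

markedAfter-distinct : (c : Link n) → AllPairs _≢_ C → AllPairs _≢_ (markedAfter c C)
markedAfter-distinct c [] = []
markedAfter-distinct c (_∷_ {x = d} d≢ C≢) with c <ₗ? d
... | yes _ = markedAfter-All d d≢ ∷ markedAfter-distinct d C≢
... | no  _ = markedAfter-distinct d C≢

deduplicate-distinct : {A : Set} (_≟_ : DecidableEquality A) {xs : List A} → AllPairs _≢_ xs → deduplicate _≟_ xs ≡ xs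
deduplicate-distinct _≟_ [] = refl
deduplicate-distinct _≟_ {x ∷ xs} (x≢ ∷ xs≢) rewrite deduplicate-distinct _≟_ xs≢ =
  cong (x ∷_) (filter-all (¬? ∘ (x ≟_)) x≢)

#M≡1+marked : (c : Link n) (C : List (Link n)) → AllPairs _≢_ (c ∷ C) → #M (c ∷ C) ≡ suc (length (markedAfter c C))
#M≡1+marked c C (c≢ ∷ C≢) = cong length
  (deduplicate-distinct _≟ₗ_ (markedAfter-All c c≢ ∷ markedAfter-distinct c C≢))

theorem7p9 : ∀ {n : ℕ} (w : Permutation′ n) (C : List (Link n)) → IsClimbingChain w C → raj w ≤ #M C
theorem7p9 w [] isChain = raj-reverse w (IsClimbingChain.product isChain)
theorem7p9 w (c ∷ C) isChain =
  subst (raj w ≤_) (sym (#M≡1+marked c C (links-distinct w climbing cl))) (raj≤1+marked w c C climbing cl)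
  where
  open IsClimbingChain isChain
  cl = climbs w (c ∷ C) links product covers
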